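{- If $i_1,i_1',i_2,\ldots,i_m$ are distinct integers, then $$\sum_{n=0}^{\infty}\bigl(G_{n+i_1}-G_{n+i_1'}\bigr)\,G_{n+i_2}G_{n+i_3}\cdots G_{n+i_m}$$ is a rational function of $C$.
   Context: Paths use steps $(1,1)$ and $(1,-1)$; a Dyck path of semilength $n$ starts at $(0,0)$, ends at $(2n,0)$ and never goes below level ($y$-coordinate) $0$; its height is the maximum level reached (the empty path has height $0$). Let $c(x)=\sum_{n\ge0}\frac{1}{n+1}\binom{2n}{n}x^n=\frac{1-\sqrt{1-4x}}{2x}$ and $C=c(x)-1=xc(x)^2$. For an integer $k$, $G_k=\sum_P x^{\text{semilength}(P)}$, the sum over all Dyck paths $P$ of height at most $k$ (so $G_k=0$ for $k<0$). The sum is a formal power series in $x$ (convergent $x$-adically), and the claim is that it equals $Q(C)$ for some rational function $Q$. -}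

module Defs where

open import Data.Nat as ℕ using (ℕ; zero; suc; NonZero)
open import Data.Nat.Combinatorics using (_C_)
open import Data.Integer as ℤ using (ℤ; +_; 0ℤ; 1ℤ; _≤_; _+_; _-_; _*_)
open import Data.Integer.Properties using (_≤?_; _≟_)
open import Data.Bool using (Bool; true; false; _∧_)
open import Data.List using (List; []; _∷_; length; filter; map; _++_)
open import Relation.Nullary.Decidable using (⌊_⌋)
open import Relation.Binary.PropositionalEquality using (_≡_)

-- Formal power series in x with integer coefficients: n ↦ [x^n]
Series : Set
Series = ℕ → ℤ

sumℤ : (ℕ → ℤ) → ℕ → ℤ
sumℤ f zero    = 0ℤ
sumℤ f (suc n) = sumℤ f n + f n

zeroS : Series
zeroS _ = 0ℤ

oneS : Series
oneS zero    = 1ℤ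
oneS (suc _) = 0ℤ

constS : ℤ → Series
constS a zero    = a
constS a (suc _) = 0ℤ

_⊕_ : Series → Series → Series
(a ⊕ b) n = a n + b n

_⊖_ : Series → Series → Series
(a ⊖ b) n = a n - b n

_⊛_ : Series → Series → Series
(a ⊛ b) n = sumℤ (λ k → a k * b (n ℕ.∸ k)) (suc n)

prodS : List Series → Series
prodS []       = oneS
prodS (s ∷ ss) = s ⊛ prodS ss

sumS : (ℕ → Series) → ℕ → Series
sumS T zero    = zeroS
sumS T (suc M) = sumS T M ⊕ T M

IsXAdicSum : (ℕ → Series) → Series → Set
IsXAdicSum T S = (N : ℕ) → Σ ℕ (λ M → (M' : ℕ) → M ℕ.≤ M' → sumS T M' N ≡ S N)
  where open import Data.Product using (Σ)

-- Polynomials with integer coefficients (coefficient list, constant term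
-- first), evaluated at a power series by Horner's rule.
Poly : Set
Poly = List ℤ

evalPoly : Poly → Series → Series
evalPoly []       s = zeroS
evalPoly (a ∷ as) s = constS a ⊕ (s ⊛ evalPoly as s)

catalan : ℕ → ℕ
catalan n = ((2 ℕ.* n) C n) ℕ./ suc n

cS : Series
cS n = + catalan n

CS : Series
CS = cS ⊖ oneS

data Step : Set where
  up down : Step

stepVal : Step → ℤ
stepVal up   = 1ℤ
stepVal down = ℤ.-[1+ 0 ]

levelsFrom : ℤ → List Step → List ℤ
levelsFrom h []       = []
levelsFrom h (s ∷ ss) = (h + stepVal s) ∷ levelsFrom (h + stepVal s) ss

levels : List Step → List ℤ
levels p = 0ℤ ∷ levelsFrom 0ℤ p

endLevel : List Step → ℤ
endLevel []       = 0ℤ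
endLevel (s ∷ ss) = stepVal s + endLevel ss

allB : (ℤ → Bool) → List ℤ → Bool
allB P []       = true
allB P (z ∷ zs) = P z ∧ allB P zs

isDyck : List Step → Bool
isDyck p = allB (λ z → ⌊ 0ℤ ≤? z ⌋) (levels p) ∧ ⌊ endLevel p ≟ 0ℤ ⌋

-- height = maximum level reached (levels always contain 0)
maxList : List ℤ → ℤ
maxList []       = 0ℤ
maxList (z ∷ zs) = z ℤ.⊔ maxList zs

height : List Step → ℤ
height p = maxList (levels p)

allPaths : ℕ → List (List Step)
allPaths zero    = [] ∷ []
allPaths (suc L) = map (up ∷_) (allPaths L) ++ map (down ∷_) (allPaths L)

dyckUpTo : ℤ → ℕ → List (List Step)
dyckUpTo k n = filter (λ p → isDyck p Data.Bool.≟ true) (filter (λ p → height p ≤? k) (allPaths (2 ℕ.* n)))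
  where import Data.Bool

G : ℤ → Series
G k n = + length (dyckUpTo k n)

IsRationalFunctionOfC : Series → Set
IsRationalFunctionOfC S =
  Σ Poly λ P → Σ Poly λ R →
    Any (λ a → ¬ (a ≡ 0ℤ)) R × ((N : ℕ) → (S ⊛ evalPoly R CS) N ≡ evalPoly P CS N)
  where
  open import Data.Product using (Σ; _×_)
  open import Data.List.Relation.Unary.Any using (Any)
  open import Relation.Nullary using (¬_)

summand : ℤ → ℤ → List ℤ → ℕ → Series
summand i1 i1' is n =
  (G (+ n + i1) ⊖ G (+ n + i1')) ⊛ prodS (map (λ i → G (+ n + i)) is)

{-# OPTIONS --safe #-}
module Submission where

-- Since G_k = 1 + x G_{k−1} G_k, induction gives, for a > b ≥ −1,
--   x G_a G_b = (1 − x G_{a−b−2}) (G_a − G_b) + G_b − 1,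
-- so x (G_{n+a} − G_{n+b}) G_{n+c} is a combination of G_{n+a} − G_{n+c} and G_{n+b} − G_{n+c} whose
-- coefficients do not depend on n. Distinctness of the indices allows the factors of the product to be
-- removed one after the other, down to Σ (G_{n+a} − G_{n+b}), which telescopes because G_k tends to c(x).
-- All coefficients are rational in C, as x = C/(1+C)² and G_k = (1+C)(1−C^{k+1})/(1−C^{k+2}).
-- Starting the summation late enough makes all the indices nonnegative.

open import Defs
open import Algebra.Bundles using (CommutativeRing)
import Algebra.Solver.Ring as RingSolver
open import Algebra.Solver.Ring.AlmostCommutativeRing
  using (fromCommutativeRing; _-Raw-AlmostCommutative⟶_)
open import Data.Bool as Bool using (Bool; true; false; _∧_; if_then_else_)
open import Data.Bool.Properties using (∧-zeroʳ)
open import Data.Empty using (⊥-elim)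
open import Data.Integer as ℤ using (ℤ; +_; -[1+_]; 0ℤ; 1ℤ; _+_; _*_; -_)
import Data.Integer.Properties as ℤP
import Data.Integer.Tactic.RingSolver as ℤR
open import Data.List using (List; []; _∷_; _++_; map; filter; length)
open import Data.List.Properties using (map-∘; map-cong)
open import Data.List.Relation.Unary.All as All using (All; []; _∷_)
import Data.List.Relation.Unary.All.Properties as AllP
open import Data.List.Relation.Unary.AllPairs as AllPairs using (_∷_)
import Data.List.Relation.Unary.AllPairs.Properties as AllPairsP
open import Data.List.Relation.Unary.Any using (Any; here; there)
open import Data.List.Relation.Unary.Unique.Propositional using (Unique)
import Data.List.Relation.Unary.Unique.Propositional.Properties as UniqueP
open import Data.Maybe as Maybe using (Maybe)
open import Data.Nat as ℕ using (ℕ; zero; suc; z≤n; s≤s)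
open import Data.Nat.Combinatorics using (_C_; nCk+nC[k+1]≡[n+1]C[k+1]; nCk≡nC[n∸k]; nC1≡n)
open import Data.Nat.DivMod using (m*n/n≡m)
import Data.Nat.Properties as ℕP
import Data.Nat.Tactic.RingSolver as ℕR
open import Data.Product using (Σ; _×_; _,_)
open import Level using (0ℓ)
open import Relation.Binary.Consequences using (dec⇒weaklyDec)
open import Relation.Binary.Definitions using (tri<; tri≈; tri>)
open import Relation.Binary.PropositionalEquality
  using (_≡_; _≢_; refl; sym; trans; cong; cong₂; subst; module ≡-Reasoning)
import Relation.Binary.Reasoning.Setoid as SetoidReasoning
open import Relation.Nullary using (¬_; Dec; yes; no)
open import Relation.Nullary.Decidable using (⌊_⌋)
open import Relation.Unary using (Decidable)

-- The ring of formal power series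

-- The product formula leaves the remainder G_b - 1, which tends to c(x) - 1 and not to 0, so the
-- products x G_{n+a} G_{n+c} cannot be summed one at a time. Only the difference of two products
-- with the same second factor is manageable: the remainder depends on that factor alone and
-- cancels. The recurrence for G_k is not visible in a definition that filters lists of steps.
-- Removing the first step of a Dyck path leaves a path that starts above the axis, so paths
-- descending from every level of a strip are counted together. The first-passage factorisation then
-- comes from the one-step equations by algebra, without a bijection. The same counts, in a strip
-- too high to matter, produce the binomial formula that defines c(x).

infix 4 _≐_
-- A record rather than the bare family of equations, so that the two series can be read off the
-- type of an equation without unfolding the ring operations.
record _≐_ (a b : Series) : Set where
  constructor coeffs
  field coeff : ∀ n → a n ≡ b n
open _≐_

tail : Series → Series
tail a n = a (suc n)

sumℤ-front : ∀ f n → sumℤ f (suc n) ≡ f 0 + sumℤ (λ k → f (suc k)) n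
sumℤ-front f zero    = ℤP.+-comm 0ℤ (f 0)
sumℤ-front f (suc n) =
  trans (cong (_+ f (suc n)) (sumℤ-front f n)) (ℤP.+-assoc (f 0) _ _)

⊛-head : ∀ a b → (a ⊛ b) 0 ≡ a 0 * b 0
⊛-head a b = ℤP.+-identityˡ _

⊛-tail : ∀ a b n → (a ⊛ b) (suc n) ≡ a 0 * b (suc n) + (tail a ⊛ b) n
⊛-tail a b n = sumℤ-front (λ k → a k * b (suc n ℕ.∸ k)) (suc n)

-- Bounding the hypotheses by `n` makes multiplication continuous in the x-adic sense: series that
-- agree only up to degree `n` may be exchanged. Limits and `catalan-equation` rely on it.
⊛-cong-≤ : ∀ {a a′ b b′} n → (∀ k → k ℕ.≤ n → a k ≡ a′ k) → (∀ k → k ℕ.≤ n → b k ≡ b′ k) →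
           (a ⊛ b) n ≡ (a′ ⊛ b′) n
⊛-cong-≤ {a} {a′} {b} {b′} zero p q
  rewrite ⊛-head a b | ⊛-head a′ b′ | p 0 ℕ.z≤n | q 0 ℕ.z≤n = refl
⊛-cong-≤ {a} {a′} {b} {b′} (suc n) p q
  rewrite ⊛-tail a b n | ⊛-tail a′ b′ n | p 0 ℕ.z≤n | q (suc n) ℕP.≤-refl =
  cong (λ z → a′ 0 * b′ (suc n) + z)
    (⊛-cong-≤ n (λ k k≤n → p (suc k) (ℕ.s≤s k≤n)) (λ k k≤n → q k (ℕP.m≤n⇒m≤1+n k≤n)))

-- Mirror image of `⊛-tail`. Commutativity follows by peeling one product at the front and the other
-- at the back.
⊛-last : ∀ a b n → (a ⊛ b) (suc n) ≡ a (suc n) * b 0 + (a ⊛ tail b) n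
⊛-last a b zero
  rewrite ⊛-tail a b 0 | ⊛-head (tail a) b | ⊛-head a (tail b) = ℤP.+-comm (a 0 * b 1) (a 1 * b 0)
⊛-last a b (suc n)
  rewrite ⊛-tail a b (suc n) | ⊛-tail a (tail b) n | ⊛-last (tail a) b n =
  swap (a 0 * b (suc (suc n))) (a (suc (suc n)) * b 0) ((tail a ⊛ tail b) n)
  where
  swap : ∀ u v w → u + (v + w) ≡ v + (u + w)
  swap = ℤR.solve-∀

⊛-comm′ : ∀ a b n → (a ⊛ b) n ≡ (b ⊛ a) n
⊛-comm′ a b zero rewrite ⊛-head a b | ⊛-head b a = ℤP.*-comm (a 0) (b 0)
⊛-comm′ a b (suc n) rewrite ⊛-tail a b n | ⊛-last b a n =
  cong₂ _+_ (ℤP.*-comm (a 0) _) (⊛-comm′ (tail a) b n)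

⊛-distribʳ′ : ∀ c a b n → ((a ⊕ b) ⊛ c) n ≡ (a ⊛ c) n + (b ⊛ c) n
⊛-distribʳ′ c a b zero rewrite ⊛-head (a ⊕ b) c | ⊛-head a c | ⊛-head b c =
  ℤP.*-distribʳ-+ (c 0) (a 0) (b 0)
⊛-distribʳ′ c a b (suc n)
  rewrite ⊛-tail (a ⊕ b) c n | ⊛-tail a c n | ⊛-tail b c n | ⊛-distribʳ′ c (tail a) (tail b) n =
  regroup (a 0) (b 0) (c (suc n)) _ _
  where
  regroup : ∀ u v w s t → (u + v) * w + (s + t) ≡ u * w + s + (v * w + t)
  regroup = ℤR.solve-∀

_·_ : ℤ → Series → Series
(k · a) n = k * a n

·-⊛ : ∀ k a b n → ((k · a) ⊛ b) n ≡ k * (a ⊛ b) n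
·-⊛ k a b zero rewrite ⊛-head (k · a) b | ⊛-head a b = ℤP.*-assoc k (a 0) (b 0)
·-⊛ k a b (suc n) rewrite ⊛-tail (k · a) b n | ⊛-tail a b n | ·-⊛ k (tail a) b n =
  factor k (a 0) (b (suc n)) _
  where
  factor : ∀ u v w s → u * v * w + u * s ≡ u * (v * w + s)
  factor = ℤR.solve-∀

zero-⊛ : ∀ a n → (zeroS ⊛ a) n ≡ 0ℤ
zero-⊛ a zero    = ⊛-head zeroS a
zero-⊛ a (suc n) rewrite ⊛-tail zeroS a n | zero-⊛ a n = ℤP.+-identityʳ (0ℤ * a (suc n))

const-⊛ : ∀ k a n → (constS k ⊛ a) n ≡ k * a n
const-⊛ k a zero    = ⊛-head (constS k) a
const-⊛ k a (suc n) rewrite ⊛-tail (constS k) a n | zero-⊛ a n = ℤP.+-identityʳ _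

-- The tail of `a ⊛ b` is `(a 0 · tail b) ⊕ (tail a ⊛ b)`, so the induction also needs
-- distributivity and scalar multiples.
⊛-assoc′ : ∀ a b c n → ((a ⊛ b) ⊛ c) n ≡ (a ⊛ (b ⊛ c)) n
⊛-assoc′ a b c zero
  rewrite ⊛-head (a ⊛ b) c | ⊛-head a (b ⊛ c) | ⊛-head a b | ⊛-head b c = ℤP.*-assoc (a 0) (b 0) (c 0)
⊛-assoc′ a b c (suc n) = begin
  ((a ⊛ b) ⊛ c) (suc n)
    ≡⟨ ⊛-tail (a ⊛ b) c n ⟩
  (a ⊛ b) 0 * c (suc n) + (tail (a ⊛ b) ⊛ c) n
    ≡⟨ cong₂ _+_ (cong (_* c (suc n)) (⊛-head a b))
         (trans (⊛-cong-≤ {b = c} {b′ = c} n (λ k _ → ⊛-tail a b k) (λ _ _ → refl))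
           (⊛-distribʳ′ c (a 0 · tail b) (tail a ⊛ b) n)) ⟩
  a 0 * b 0 * c (suc n) + (((a 0 · tail b) ⊛ c) n + ((tail a ⊛ b) ⊛ c) n)
    ≡⟨ cong (λ z → a 0 * b 0 * c (suc n) + z) (cong₂ _+_ (·-⊛ (a 0) (tail b) c n) (⊛-assoc′ (tail a) b c n)) ⟩
  a 0 * b 0 * c (suc n) + (a 0 * (tail b ⊛ c) n + (tail a ⊛ (b ⊛ c)) n)
    ≡⟨ factor (a 0) (b 0) (c (suc n)) _ _ ⟩
  a 0 * (b 0 * c (suc n) + (tail b ⊛ c) n) + (tail a ⊛ (b ⊛ c)) n
    ≡⟨ cong (λ z → a 0 * z + (tail a ⊛ (b ⊛ c)) n) (⊛-tail b c n) ⟨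
  a 0 * (b ⊛ c) (suc n) + (tail a ⊛ (b ⊛ c)) n
    ≡⟨ ⊛-tail a (b ⊛ c) n ⟨
  (a ⊛ (b ⊛ c)) (suc n) ∎
  where
  open ≡-Reasoning
  factor : ∀ u v w s t → u * v * w + (u * s + t) ≡ u * (v * w + s) + t
  factor = ℤR.solve-∀

⊝_ : Series → Series
(⊝ a) n = - a n

oneS≗const : ∀ n → oneS n ≡ constS 1ℤ n
oneS≗const zero    = refl
oneS≗const (suc n) = refl

one-⊛ : ∀ a n → (oneS ⊛ a) n ≡ a n
one-⊛ a n = trans (⊛-cong-≤ {b = a} {b′ = a} n (λ k _ → oneS≗const k) (λ _ _ → refl))
                  (trans (const-⊛ 1ℤ a n) (ℤP.*-identityˡ (a n)))

seriesRing : CommutativeRing 0ℓ 0ℓ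
seriesRing = record
  { Carrier = Series ; _≈_ = _≐_ ; _+_ = _⊕_ ; _*_ = _⊛_ ; -_ = ⊝_ ; 0# = zeroS ; 1# = oneS
  ; isCommutativeRing = record
    { isRing = record
      { +-isAbelianGroup = record
        { isGroup = record
          { isMonoid = record
            { isSemigroup = record
              { isMagma = record
                { isEquivalence = record
                  { refl  = coeffs λ _ → refl
                  ; sym   = λ p → coeffs λ n → sym (coeff p n)
                  ; trans = λ p q → coeffs λ n → trans (coeff p n) (coeff q n)
                  }
                ; ∙-cong = λ p q → coeffs λ n → cong₂ _+_ (coeff p n) (coeff q n)
                }
              ; assoc = λ a b c → coeffs λ n → ℤP.+-assoc (a n) (b n) (c n)
              }
            ; identity = (λ a → coeffs λ n → ℤP.+-identityˡ (a n))
                       , (λ a → coeffs λ n → ℤP.+-identityʳ (a n))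
            }
          ; inverse = (λ a → coeffs λ n → ℤP.+-inverseˡ (a n))
                    , (λ a → coeffs λ n → ℤP.+-inverseʳ (a n))
          ; ⁻¹-cong = λ p → coeffs λ n → cong -_ (coeff p n)
          }
        ; comm = λ a b → coeffs λ n → ℤP.+-comm (a n) (b n)
        }
      ; *-cong = λ {a} {a′} {b} {b′} p q → coeffs λ n →
          ⊛-cong-≤ {a} {a′} {b} {b′} n (λ k _ → coeff p k) (λ k _ → coeff q k)
      ; *-assoc = λ a b c → coeffs (⊛-assoc′ a b c)
      ; *-identity = (λ a → coeffs (one-⊛ a))
                   , (λ a → coeffs λ n → trans (⊛-comm′ a oneS n) (one-⊛ a n))
      ; distrib = (λ c a b → coeffs λ n → trans (⊛-comm′ c (a ⊕ b) n)
                      (trans (⊛-distribʳ′ c a b n) (cong₂ _+_ (⊛-comm′ a c n) (⊛-comm′ b c n))))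
                , (λ c a b → coeffs (⊛-distribʳ′ c a b))
      }
    ; *-comm = λ a b → coeffs (⊛-comm′ a b)
    }
  }

open CommutativeRing seriesRing using (setoid)
  renaming (refl to ≐-refl; sym to ≐-sym; trans to ≐-trans;
            +-cong to ⊕-cong; *-cong to ⊛-cong)

⊕-congˡ : ∀ c {a b} → a ≐ b → c ⊕ a ≐ c ⊕ b
⊕-congˡ c a≐b = ⊕-cong (≐-refl {c}) a≐b

⊛-congˡ : ∀ c {a b} → a ≐ b → c ⊛ a ≐ c ⊛ b
⊛-congˡ c a≐b = ⊛-cong (≐-refl {c}) a≐b

constHom : CommutativeRing.rawRing ℤP.+-*-commutativeRing
             -Raw-AlmostCommutative⟶ fromCommutativeRing seriesRing
constHom = record
  { ⟦_⟧    = constS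
  ; +-homo = λ j k → coeffs λ { zero → refl ; (suc n) → refl }
  ; *-homo = λ j k → coeffs λ n → sym (trans (const-⊛ j (constS k) n) (times j k n))
  ; -‿homo = λ k → coeffs λ { zero → refl ; (suc n) → refl }
  ; 0-homo = coeffs λ { zero → refl ; (suc n) → refl }
  ; 1-homo = coeffs λ n → sym (oneS≗const n)
  }
  where
  times : ∀ j k n → j * constS k n ≡ constS (j * k) n
  times j k zero    = refl
  times j k (suc n) = ℤP.*-zeroʳ j

constS-≟ : ∀ j k → Maybe (constS j ≐ constS k)
constS-≟ j k = Maybe.map (λ { refl → ≐-refl }) (dec⇒weaklyDec ℤP._≟_ j k)

module SeriesSolver = RingSolver _ (fromCommutativeRing seriesRing) constHom constS-≟
open SeriesSolver using (solve; _:=_; _:+_; _:*_; _:-_; :-_; con)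

-- Counting lattice paths in a strip

⌊⌋-true : ∀ {P : Set} (P? : Dec P) → P → ⌊ P? ⌋ ≡ true
⌊⌋-true (yes _) p = refl
⌊⌋-true (no ¬p) p = ⊥-elim (¬p p)

⌊⌋-false : ∀ {P : Set} (P? : Dec P) → ¬ P → ⌊ P? ⌋ ≡ false
⌊⌋-false (yes p) ¬p = ⊥-elim (¬p p)
⌊⌋-false (no _)  ¬p = refl

count : ∀ {A : Set} → (A → Bool) → List A → ℕ
count f []       = 0
count f (x ∷ xs) = (if f x then 1 else 0) ℕ.+ count f xs

count-cong : ∀ {A : Set} {f g : A → Bool} → (∀ x → f x ≡ g x) → ∀ xs → count f xs ≡ count g xs
count-cong f≗g []       = refl
count-cong f≗g (x ∷ xs) = cong₂ (λ b n → (if b then 1 else 0) ℕ.+ n) (f≗g x) (count-cong f≗g xs)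

count-++ : ∀ {A : Set} (f : A → Bool) xs ys → count f (xs ++ ys) ≡ count f xs ℕ.+ count f ys
count-++ f []       ys = refl
count-++ f (x ∷ xs) ys rewrite count-++ f xs ys =
  sym (ℕP.+-assoc (if f x then 1 else 0) (count f xs) (count f ys))

count-map : ∀ {A B : Set} (f : B → Bool) (g : A → B) xs →
            count f (map g xs) ≡ count (λ x → f (g x)) xs
count-map f g []       = refl
count-map f g (x ∷ xs) = cong (_ ℕ.+_) (count-map f g xs)

count-false : ∀ {A : Set} (xs : List A) → count (λ _ → false) xs ≡ 0
count-false []       = refl
count-false (x ∷ xs) = count-false xs

count-filters : ∀ {A : Set} {P : A → Set} (P? : Decidable P) (f : A → Bool) xs →
  length (filter (λ x → f x Bool.≟ true) (filter P? xs)) ≡ count (λ x → ⌊ P? x ⌋ ∧ f x) xs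
count-filters P? f [] = refl
count-filters P? f (x ∷ xs) with P? x
... | no _  = count-filters P? f xs
... | yes _ with f x
...   | true  = cong suc (count-filters P? f xs)
...   | false = count-filters P? f xs

-- The conditions "height at most `k`" and "Dyck", freed from the starting level 0 so that they can
-- be followed along a path.
inStrip : ℤ → ℤ → List Step → Bool
inStrip k z p = allB (λ y → ⌊ y ℤP.≤? k ⌋) (z ∷ levelsFrom z p)
              ∧ (allB (λ y → ⌊ 0ℤ ℤP.≤? y ⌋) (z ∷ levelsFrom z p) ∧ ⌊ z + endLevel p ℤP.≟ 0ℤ ⌋)

inStrip-step : ∀ k z s p → z ℤ.≤ k → 0ℤ ℤ.≤ z → inStrip k z (s ∷ p) ≡ inStrip k (z + stepVal s) p
inStrip-step k z s p z≤k 0≤z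
  rewrite ⌊⌋-true (z ℤP.≤? k) z≤k | ⌊⌋-true (0ℤ ℤP.≤? z) 0≤z
        | ℤP.+-assoc z (stepVal s) (endLevel p) = refl

inStrip-above : ∀ k z p → ¬ z ℤ.≤ k → inStrip k z p ≡ false
inStrip-above k z p z≰k rewrite ⌊⌋-false (z ℤP.≤? k) z≰k = refl

inStrip-below : ∀ k z p → ¬ 0ℤ ℤ.≤ z → inStrip k z p ≡ false
inStrip-below k z p 0≰z rewrite ⌊⌋-false (0ℤ ℤP.≤? z) 0≰z = ∧-zeroʳ _

-- The numbers are the room left above the current level, and that level.
walk : List Step → ℕ → ℕ → Bool
walk []         r       zero    = true
walk []         r       (suc h) = false
walk (up ∷ p)   zero    h       = false
walk (up ∷ p)   (suc r) h       = walk p r (suc h)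
walk (down ∷ p) r       zero    = false
walk (down ∷ p) r       (suc h) = walk p (suc r) h

-- Room plus level is the ceiling of the strip. Every step preserves this sum, and a path leaves the
-- strip exactly when one of the two numbers would become negative.
walk-inStrip : ∀ r h p → walk p r h ≡ inStrip (+ (r ℕ.+ h)) (+ h) p
walk-inStrip r zero []
  rewrite ⌊⌋-true (+ 0 ℤP.≤? + (r ℕ.+ 0)) (ℤ.+≤+ z≤n) = refl
walk-inStrip r (suc h) []
  rewrite ⌊⌋-true (+ suc h ℤP.≤? + (r ℕ.+ suc h)) (ℤ.+≤+ (ℕP.m≤n+m (suc h) r))
        | ⌊⌋-true (0ℤ ℤP.≤? + suc h) (ℤ.+≤+ z≤n)
        | ⌊⌋-false (+ suc h + 0ℤ ℤP.≟ 0ℤ) (λ ()) = refl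
walk-inStrip zero h (up ∷ p) = sym (trans
  (inStrip-step (+ h) (+ h) up p ℤP.≤-refl (ℤ.+≤+ z≤n))
  (inStrip-above (+ h) (+ h + 1ℤ) p
    λ { (ℤ.+≤+ h+1≤h) → ℕP.1+n≰n (subst (ℕ._≤ h) (ℕP.+-comm h 1) h+1≤h) }))
walk-inStrip (suc r) h (up ∷ p) = begin
  walk p r (suc h)
    ≡⟨ walk-inStrip r (suc h) p ⟩
  inStrip (+ (r ℕ.+ suc h)) (+ suc h) p
    ≡⟨ cong₂ (λ k z → inStrip (+ k) (+ z) p) (ℕP.+-suc r h) (ℕP.+-comm 1 h) ⟩
  inStrip (+ suc (r ℕ.+ h)) (+ h + 1ℤ) p
    ≡⟨ inStrip-step (+ suc (r ℕ.+ h)) (+ h) up p (ℤ.+≤+ (ℕP.m≤n+m h (suc r))) (ℤ.+≤+ z≤n) ⟨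
  inStrip (+ suc (r ℕ.+ h)) (+ h) (up ∷ p) ∎
  where open ≡-Reasoning
walk-inStrip r zero (down ∷ p) = sym (trans
  (inStrip-step (+ (r ℕ.+ 0)) 0ℤ down p (ℤ.+≤+ z≤n) (ℤ.+≤+ z≤n))
  (inStrip-below (+ (r ℕ.+ 0)) (stepVal down) p λ ()))
walk-inStrip r (suc h) (down ∷ p) = begin
  walk p (suc r) h
    ≡⟨ walk-inStrip (suc r) h p ⟩
  inStrip (+ suc (r ℕ.+ h)) (+ h) p
    ≡⟨ cong (λ k → inStrip (+ k) (+ h) p) (ℕP.+-suc r h) ⟨
  inStrip (+ (r ℕ.+ suc h)) (+ h) p
    ≡⟨ inStrip-step (+ (r ℕ.+ suc h)) (+ suc h) down p (ℤ.+≤+ (ℕP.m≤n+m (suc h) r)) (ℤ.+≤+ z≤n) ⟨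
  inStrip (+ (r ℕ.+ suc h)) (+ suc h) (down ∷ p) ∎
  where open ≡-Reasoning

walks : ℕ → ℕ → ℕ → ℕ
walks r h L = count (λ p → walk p r h) (allPaths L)

-- The bound has the form `+ k` because `maxList` starts from the default `0ℤ`, which must itself
-- satisfy the bound.
maxList-≤ : ∀ k zs → ⌊ maxList zs ℤP.≤? + k ⌋ ≡ allB (λ z → ⌊ z ℤP.≤? + k ⌋) zs
maxList-≤ k [] = refl
maxList-≤ k (z ∷ zs) with z ℤP.≤? + k | maxList zs ℤP.≤? + k | maxList-≤ k zs
... | yes z≤k | yes m≤k | eq = trans (⌊⌋-true (_ ℤP.≤? _) (ℤP.⊔-lub z≤k m≤k)) eq
... | yes z≤k | no m≰k  | eq =
  trans (⌊⌋-false (_ ℤP.≤? _) λ le → m≰k (ℤP.≤-trans (ℤP.i≤j⊔i z (maxList zs)) le)) eq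
... | no z≰k  | _       | eq =
  ⌊⌋-false (_ ℤP.≤? _) λ le → z≰k (ℤP.≤-trans (ℤP.i≤i⊔j z (maxList zs)) le)

G-walks : ∀ k n → G (+ k) n ≡ + walks k 0 (2 ℕ.* n)
G-walks k n = cong +_ (trans (count-filters (λ p → height p ℤP.≤? + k) isDyck (allPaths (2 ℕ.* n)))
  (count-cong dyck-walk (allPaths (2 ℕ.* n))))
  where
  dyck-walk : ∀ p → ⌊ height p ℤP.≤? + k ⌋ ∧ isDyck p ≡ walk p k 0
  dyck-walk p rewrite maxList-≤ k (levels p) | walk-inStrip k 0 p
    | ℕP.+-identityʳ k | ℤP.+-identityˡ (endLevel p) = refl

walks-step : ∀ r h L → walks r h (suc L) ≡
  count (λ p → walk (up ∷ p) r h) (allPaths L) ℕ.+ count (λ p → walk (down ∷ p) r h) (allPaths L)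
walks-step r h L = trans (count-++ (λ p → walk p r h) (map (up ∷_) (allPaths L)) _)
  (cong₂ ℕ._+_ (count-map (λ p → walk p r h) (up ∷_) (allPaths L))
             (count-map (λ p → walk p r h) (down ∷_) (allPaths L)))

walks-no-room : ∀ h L → walks 0 (suc h) (suc L) ≡ walks 1 h L
walks-no-room h L rewrite walks-step 0 (suc h) L | count-false (allPaths L) = refl

walks-ground : ∀ r L → walks (suc r) 0 (suc L) ≡ walks r 1 L
walks-ground r L rewrite walks-step (suc r) 0 L | count-false (allPaths L) = ℕP.+-identityʳ _

walks-stuck : ∀ L → walks 0 0 (suc L) ≡ 0
walks-stuck L rewrite walks-step 0 0 L | count-false (allPaths L) = refl

walks-inside : ∀ r h L →
  walks (suc r) (suc h) (suc L) ≡ walks r (suc (suc h)) L ℕ.+ walks (suc (suc r)) h L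
walks-inside r h L = walks-step (suc r) (suc h) L

walks-short : ∀ r h L → L ℕ.< h → walks r h L ≡ 0
walks-short r (suc h) zero L<h = refl
walks-short zero (suc h) (suc L) (s≤s L<h) =
  trans (walks-no-room h L) (walks-short 1 h L L<h)
walks-short (suc r) (suc h) (suc L) (s≤s L<h)
  rewrite walks-inside r h L
        | walks-short r (suc (suc h)) L (ℕP.m≤n⇒m≤1+n (ℕP.m≤n⇒m≤1+n L<h)) =
  walks-short (suc (suc r)) h L L<h

-- Walks from level h to level 0 are counted by their number n of up steps, so their length is h + 2n.
descents : ℕ → ℕ → ℕ → ℕ
descents r h n = walks r h (h ℕ.+ 2 ℕ.* n)

descents-stuck : ∀ n → descents 0 0 (suc n) ≡ 0
descents-stuck n = walks-stuck (n ℕ.+ suc (n ℕ.+ 0))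

descents-ground : ∀ r n → descents (suc r) 0 (suc n) ≡ descents r 1 n
descents-ground r n = trans (walks-ground r (n ℕ.+ suc (n ℕ.+ 0)))
  (cong (walks r 1) (ℕP.+-suc n (n ℕ.+ 0)))

descents-no-room : ∀ h n → descents 0 (suc h) n ≡ descents 1 h n
descents-no-room h n = walks-no-room h (h ℕ.+ 2 ℕ.* n)

-- After an up step, `h` steps would remain to come down from level `h + 2`, so that branch is
-- empty.
descents-inside₀ : ∀ r h → descents (suc r) (suc h) 0 ≡ descents (suc (suc r)) h 0
descents-inside₀ r h rewrite walks-inside r h (h ℕ.+ 0)
  | walks-short r (suc (suc h)) (h ℕ.+ 0) (ℕP.m≤n⇒m≤1+n (s≤s (ℕP.≤-reflexive (ℕP.+-identityʳ h)))) = refl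

descents-inside : ∀ r h n →
  descents (suc r) (suc h) (suc n) ≡ descents (suc (suc r)) h (suc n) ℕ.+ descents r (suc (suc h)) n
descents-inside r h n = trans (walks-inside r h (h ℕ.+ 2 ℕ.* suc n))
  (trans (ℕP.+-comm (walks r (suc (suc h)) (h ℕ.+ 2 ℕ.* suc n)) _)
    (cong (λ L → descents (suc (suc r)) h (suc n) ℕ.+ walks r (suc (suc h)) L) (double h n)))
  where
  double : ∀ h n → h ℕ.+ 2 ℕ.* suc n ≡ suc (suc (h ℕ.+ 2 ℕ.* n))
  double = ℕR.solve-∀

-- Ballot numbers and Catalan numbers

-- Counts the reflected paths. The value at `n = 0` has to be 0, whereas truncated subtraction would
-- give the binomial coefficient 1.
C[n-1] : ℕ → ℕ → ℕ
C[n-1] m zero    = 0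
C[n-1] m (suc n) = m C n

pascal : ∀ m n → suc m C n ≡ m C n ℕ.+ C[n-1] m n
pascal m zero    = refl
pascal m (suc n) = trans (sym (nCk+nC[k+1]≡[n+1]C[k+1] m n)) (ℕP.+-comm (m C n) _)

descents-straight : ∀ r h → descents r h 0 ≡ 1
descents-straight r       zero    = refl
descents-straight zero    (suc h) = trans (descents-no-room h 0) (descents-straight 1 h)
descents-straight (suc r) (suc h) = trans (descents-inside₀ r h) (descents-straight (suc (suc r)) h)

-- André's reflection principle, valid when the n up steps cannot exhaust the room.
ballot : ∀ r h n → n ℕ.≤ r →
  descents r h n ℕ.+ C[n-1] (h ℕ.+ 2 ℕ.* n) n ≡ (h ℕ.+ 2 ℕ.* n) C n
ballot r h zero n≤r = trans (ℕP.+-identityʳ _) (descents-straight r h)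
ballot (suc r) zero (suc n) (s≤s n≤r) = begin
  descents (suc r) 0 (suc n) ℕ.+ (2 ℕ.* suc n) C n
    ≡⟨ cong₂ (λ d L → d ℕ.+ L C n) (descents-ground r n) double ⟩
  descents r 1 n ℕ.+ suc m C n
    ≡⟨ cong (descents r 1 n ℕ.+_) (pascal m n) ⟩
  descents r 1 n ℕ.+ (m C n ℕ.+ C[n-1] m n)
    ≡⟨ swap (descents r 1 n) (m C n) (C[n-1] m n) ⟩
  m C n ℕ.+ (descents r 1 n ℕ.+ C[n-1] m n)
    ≡⟨ cong (m C n ℕ.+_) (ballot r 1 n n≤r) ⟩
  m C n ℕ.+ m C n
    ≡⟨ cong (m C n ℕ.+_) middle ⟩
  m C n ℕ.+ m C suc n
    ≡⟨ nCk+nC[k+1]≡[n+1]C[k+1] m n ⟩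
  suc m C suc n
    ≡⟨ cong (_C suc n) double ⟨
  (2 ℕ.* suc n) C suc n ∎
  where
  open ≡-Reasoning
  m = 1 ℕ.+ 2 ℕ.* n
  double : 2 ℕ.* suc n ≡ suc m
  double = cong suc (ℕP.+-suc n (n ℕ.+ 0))
  swap : ∀ a b c → a ℕ.+ (b ℕ.+ c) ≡ b ℕ.+ (a ℕ.+ c)
  swap = ℕR.solve-∀
  -- Level 0 has no down step to supply the second Pascal term; the symmetry of the odd row
  -- `m = 1 + 2n` supplies it.
  middle : m C n ≡ m C suc n
  middle = trans (nCk≡nC[n∸k] {n} {m} (ℕP.m≤n⇒m≤1+n (ℕP.m≤m+n n (n ℕ.+ 0))))
    (cong (m C_) (trans (ℕP.+-∸-assoc 1 (ℕP.m≤m+n n (n ℕ.+ 0)))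
      (cong suc (trans (ℕP.m+n∸m≡n n (n ℕ.+ 0)) (ℕP.+-identityʳ n)))))
ballot (suc r) (suc h) (suc n) (s≤s n≤r) = begin
  descents (suc r) (suc h) (suc n) ℕ.+ suc m C n
    ≡⟨ cong₂ ℕ._+_ (descents-inside r h n) (pascal m n) ⟩
  descents (suc (suc r)) h (suc n) ℕ.+ descents r (suc (suc h)) n ℕ.+ (m C n ℕ.+ C[n-1] m n)
    ≡⟨ regroup (descents (suc (suc r)) h (suc n)) (descents r (suc (suc h)) n) (m C n) (C[n-1] m n) ⟩
  (descents (suc (suc r)) h (suc n) ℕ.+ m C n) ℕ.+ (descents r (suc (suc h)) n ℕ.+ C[n-1] m n)
    ≡⟨ cong₂ ℕ._+_ (ballot (suc (suc r)) h (suc n) (s≤s (ℕP.m≤n⇒m≤1+n n≤r)))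
         (cong (λ L → descents r (suc (suc h)) n ℕ.+ C[n-1] L n) (double h n)) ⟩
  m C suc n ℕ.+ (descents r (suc (suc h)) n ℕ.+ C[n-1] (suc (suc h) ℕ.+ 2 ℕ.* n) n)
    ≡⟨ cong (m C suc n ℕ.+_) (ballot r (suc (suc h)) n n≤r) ⟩
  m C suc n ℕ.+ (suc (suc h) ℕ.+ 2 ℕ.* n) C n
    ≡⟨ cong (λ L → m C suc n ℕ.+ L C n) (double h n) ⟨
  m C suc n ℕ.+ m C n
    ≡⟨ pascal m (suc n) ⟨
  suc m C suc n ∎
  where
  open ≡-Reasoning
  m = h ℕ.+ 2 ℕ.* suc n
  double : ∀ h n → h ℕ.+ 2 ℕ.* suc n ≡ suc (suc (h ℕ.+ 2 ℕ.* n))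
  double = ℕR.solve-∀
  regroup : ∀ a b c d → a ℕ.+ b ℕ.+ (c ℕ.+ d) ≡ (a ℕ.+ c) ℕ.+ (b ℕ.+ d)
  regroup = ℕR.solve-∀

absorption : ∀ m k → suc k ℕ.* (suc m C suc k) ≡ suc m ℕ.* (m C k)
absorption m zero = trans (ℕP.*-identityˡ (suc m C 1)) (trans (nC1≡n (suc m)) (sym (ℕP.*-identityʳ (suc m))))
absorption zero (suc k) = ℕP.*-zeroʳ (suc (suc k))
absorption (suc m) (suc k) = begin
  suc (suc k) ℕ.* (suc (suc m) C suc (suc k))
    ≡⟨ cong (suc (suc k) ℕ.*_) (nCk+nC[k+1]≡[n+1]C[k+1] (suc m) (suc k)) ⟨
  suc (suc k) ℕ.* (suc m C suc k ℕ.+ suc m C suc (suc k))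
    ≡⟨ split (suc k) (suc m C suc k) (suc m C suc (suc k)) ⟩
  suc m C suc k ℕ.+ (suc k ℕ.* (suc m C suc k) ℕ.+ suc (suc k) ℕ.* (suc m C suc (suc k)))
    ≡⟨ cong (suc m C suc k ℕ.+_) (cong₂ ℕ._+_ (absorption m k) (absorption m (suc k))) ⟩
  suc m C suc k ℕ.+ (suc m ℕ.* (m C k) ℕ.+ suc m ℕ.* (m C suc k))
    ≡⟨ cong (suc m C suc k ℕ.+_) (ℕP.*-distribˡ-+ (suc m) (m C k) (m C suc k)) ⟨
  suc m C suc k ℕ.+ suc m ℕ.* (m C k ℕ.+ m C suc k)
    ≡⟨ cong (λ z → suc m C suc k ℕ.+ suc m ℕ.* z) (nCk+nC[k+1]≡[n+1]C[k+1] m k) ⟩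
  suc (suc m) ℕ.* (suc m C suc k) ∎
  where
  open ≡-Reasoning
  split : ∀ k a b → suc k ℕ.* (a ℕ.+ b) ≡ a ℕ.+ (k ℕ.* a ℕ.+ suc k ℕ.* b)
  split = ℕR.solve-∀

central-ratio : ∀ n → suc n ℕ.* C[n-1] (2 ℕ.* n) n ≡ n ℕ.* ((2 ℕ.* n) C n)
central-ratio zero    = refl
-- Adding `suc n ℕ.* (m C n)` makes the left factor `suc m` and the right side a Pascal sum, so that
-- `absorption` links them.
central-ratio (suc n) = ℕP.+-cancelˡ-≡ (suc n ℕ.* (m C n)) _ _ (begin
  suc n ℕ.* (m C n) ℕ.+ suc (suc n) ℕ.* (m C n)
    ≡⟨ ℕP.*-distribʳ-+ (m C n) (suc n) (suc (suc n)) ⟨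
  (suc n ℕ.+ suc (suc n)) ℕ.* (m C n)
    ≡⟨ cong (ℕ._* (m C n)) (double n) ⟩
  suc m ℕ.* (m C n)
    ≡⟨ absorption m n ⟨
  suc n ℕ.* (suc m C suc n)
    ≡⟨ cong (suc n ℕ.*_) (nCk+nC[k+1]≡[n+1]C[k+1] m n) ⟨
  suc n ℕ.* (m C n ℕ.+ m C suc n)
    ≡⟨ ℕP.*-distribˡ-+ (suc n) (m C n) (m C suc n) ⟩
  suc n ℕ.* (m C n) ℕ.+ suc n ℕ.* (m C suc n) ∎)
  where
  open ≡-Reasoning
  m = 2 ℕ.* suc n
  double : ∀ n → suc n ℕ.+ suc (suc n) ≡ suc (2 ℕ.* suc n)
  double = ℕR.solve-∀

-- By `ballot` the count is a difference of neighbouring binomial coefficients, and `central-ratio`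
-- turns this into `c ≡ d ℕ.* suc n`. Hence the division in `catalan` is exact.
descents-catalan : ∀ r n → n ℕ.≤ r → descents r 0 n ≡ catalan n
descents-catalan r n n≤r = sym (trans (cong (ℕ._/ suc n) central) (m*n/n≡m d (suc n)))
  where
  open ≡-Reasoning
  d = descents r 0 n
  c = (2 ℕ.* n) C n
  c′ = C[n-1] (2 ℕ.* n) n
  central : c ≡ d ℕ.* suc n
  central = ℕP.+-cancelʳ-≡ (n ℕ.* c) c (d ℕ.* suc n) (begin
    suc n ℕ.* c                         ≡⟨ cong (suc n ℕ.*_) (ballot r 0 n n≤r) ⟨
    suc n ℕ.* (d ℕ.+ c′)                ≡⟨ ℕP.*-distribˡ-+ (suc n) d c′ ⟩
    suc n ℕ.* d ℕ.+ suc n ℕ.* c′        ≡⟨ cong₂ ℕ._+_ (ℕP.*-comm (suc n) d) (central-ratio n) ⟩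
    d ℕ.* suc n ℕ.+ n ℕ.* c             ∎)

-- Recurrences for the generating functions

module ≐-Reasoning = SetoidReasoning setoid

-- If l − r is the multiple m (p − q) of a known equation, then l equals r.
eliminate : ∀ m {p q l r} → p ≐ q → l ⊕ (m ⊛ q) ≐ r ⊕ (m ⊛ p) → l ≐ r
eliminate m {p} {q} {l} {r} p≐q eq = begin
  l                                   ≈⟨ solve 2 (λ l s → l := (l :+ s) :- s) ≐-refl l (m ⊛ q) ⟩
  (l ⊕ (m ⊛ q)) ⊕ (⊝ (m ⊛ q))         ≈⟨ ⊕-cong (≐-trans eq (⊕-congˡ r (⊛-congˡ m p≐q))) (≐-refl {⊝ (m ⊛ q)}) ⟩
  (r ⊕ (m ⊛ q)) ⊕ (⊝ (m ⊛ q))         ≈⟨ solve 2 (λ r s → (r :+ s) :- s := r) ≐-refl r (m ⊛ q) ⟩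
  r                                   ∎
  where open ≐-Reasoning

-- `𝟙` is `constS 1ℤ` because this is what `con 1ℤ` denotes in the solver; `oneS` agrees with it
-- only coefficientwise.
𝟙 X : Series
𝟙 = constS 1ℤ
X zero          = 0ℤ
X (suc zero)    = 1ℤ
X (suc (suc n)) = 0ℤ

zeroS≐const : zeroS ≐ constS 0ℤ
zeroS≐const = coeffs λ { zero → refl ; (suc n) → refl }

X-⊛-zero : ∀ a → (X ⊛ a) 0 ≡ 0ℤ
X-⊛-zero a = ⊛-head X a

X-⊛-suc : ∀ a n → (X ⊛ a) (suc n) ≡ a n
X-⊛-suc a n = trans (⊛-tail X a n) (trans (ℤP.+-identityˡ _)
  (trans (⊛-cong-≤ {tail X} {oneS} {a} {a} n (λ { zero _ → refl ; (suc k) _ → refl }) (λ _ _ → refl)) (one-⊛ a n)))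

descentSeries : ℕ → ℕ → Series
descentSeries r h n = + descents r h n

descentSeries-stuck : descentSeries 0 0 ≐ 𝟙
descentSeries-stuck = coeffs λ { zero → refl ; (suc n) → cong +_ (descents-stuck n) }

descentSeries-ground : ∀ r → descentSeries (suc r) 0 ≐ 𝟙 ⊕ (X ⊛ descentSeries r 1)
descentSeries-ground r = coeffs λ
  { zero    → sym (cong (λ z → 1ℤ + z) (X-⊛-zero (descentSeries r 1)))
  ; (suc n) → trans (cong +_ (descents-ground r n))
      (sym (trans (ℤP.+-identityˡ _) (X-⊛-suc (descentSeries r 1) n))) }

descentSeries-no-room : ∀ h → descentSeries 0 (suc h) ≐ descentSeries 1 h
descentSeries-no-room h = coeffs λ n → cong +_ (descents-no-room h n)

descentSeries-inside : ∀ r h →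
  descentSeries (suc r) (suc h) ≐ descentSeries (suc (suc r)) h ⊕ (X ⊛ descentSeries r (suc (suc h)))
descentSeries-inside r h = coeffs λ
  { zero    → trans (cong +_ (descents-inside₀ r h))
      (sym (trans (cong (λ z → + descents (suc (suc r)) h 0 + z) (X-⊛-zero (descentSeries r (suc (suc h)))))
        (ℤP.+-identityʳ _)))
  ; (suc n) → trans (cong +_ (descents-inside r h n))
      (sym (cong (λ z → + descents (suc (suc r)) h (suc n) + z) (X-⊛-suc (descentSeries r (suc (suc h))) n))) }

-- Cut a descent from level `h + 1` at its first arrival at level `h`. Before the down step that
-- arrives there, the path is a Dyck path with room `r`; afterwards it is a descent from `h` with
-- room `r + 1`. Down steps carry no weight, so no factor x appears.
first-passage : ∀ r h → descentSeries r (suc h) ≐ descentSeries r 0 ⊛ descentSeries (suc r) h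
ground-recurrence : ∀ r → descentSeries (suc r) 0
                        ≐ 𝟙 ⊕ (X ⊛ (descentSeries r 0 ⊛ descentSeries (suc r) 0))

ground-recurrence r =
  ≐-trans (descentSeries-ground r) (⊕-congˡ 𝟙 (⊛-congˡ X (first-passage r 0)))

first-passage zero h = ≐-trans (descentSeries-no-room h)
  (≐-trans (solve 1 (λ d → d := con 1ℤ :* d) ≐-refl (descentSeries 1 h))
    (⊛-cong (≐-sym descentSeries-stuck) (≐-refl {descentSeries 1 h})))
first-passage (suc r) h =
  -- Multiply `decompose` by `G′` and replace x G₀ G′ by G′ - 1: the term G′ A cancels and A = G′ B
  -- remains, without inverting 1 - x G₀.
  eliminate G′ {A} {B ⊕ (X ⊛ (G₀ ⊛ A))} decompose
    (eliminate (⊝ A) {G′} {𝟙 ⊕ (X ⊛ (G₀ ⊛ G′))} (ground-recurrence r)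
      (solve 5 (λ x g g′ a b →
        (a :+ g′ :* (b :+ x :* (g :* a))) :+ (:- a) :* (con 1ℤ :+ x :* (g :* g′))
        := (g′ :* b :+ g′ :* a) :+ (:- a) :* g′)
        ≐-refl X G₀ G′ A B))
  where
  A = descentSeries (suc r) (suc h)
  B = descentSeries (suc (suc r)) h
  G₀ = descentSeries r 0
  G′ = descentSeries (suc r) 0
  decompose : A ≐ B ⊕ (X ⊛ (G₀ ⊛ A))
  decompose = ≐-trans (descentSeries-inside r h)
    (⊕-congˡ B (⊛-congˡ X (first-passage r (suc h))))

-- H k is the paper's G_{k−1}, so that H 0 = 0 starts the recurrence.
H : ℕ → Series
H zero    = zeroS
H (suc k) = G (+ k)

G-descents : ∀ k → G (+ k) ≐ descentSeries k 0
G-descents k = coeffs (G-walks k)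

H-recurrence : ∀ k → H (suc k) ≐ 𝟙 ⊕ (X ⊛ (H k ⊛ H (suc k)))
H-recurrence zero =
  eliminate 𝟙 (≐-trans (G-descents 0) descentSeries-stuck)
    -- To the solver `zeroS` is a variable, so its vanishing enters as one more equation.
    (eliminate (⊝ (X ⊛ H 1)) zeroS≐const
      (solve 3 (λ x z h →
        (h :+ con 1ℤ :* con 1ℤ) :+ (:- (x :* h)) :* con 0ℤ
        := ((con 1ℤ :+ x :* (z :* h)) :+ con 1ℤ :* h) :+ (:- (x :* h)) :* z)
        ≐-refl X zeroS (H 1)))
H-recurrence (suc k) = ≐-trans (G-descents (suc k)) (≐-trans (ground-recurrence k)
  (⊕-congˡ 𝟙 (⊛-congˡ X (⊛-cong (≐-sym (G-descents k)) (≐-sym (G-descents (suc k)))))))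

-- A Dyck path of semilength `n` has height at most `n`, so for `n ≤ k` the height bound excludes
-- nothing. This is the convergence of G_k to c(x), with an explicit rate.
H-catalan : ∀ k n → n ℕ.≤ k → H (suc k) n ≡ cS n
H-catalan k n n≤k = trans (G-walks k n) (cong +_ (descents-catalan k n n≤k))

-- The limit of `H-recurrence`: its coefficient of degree `n` at index `n + 1` involves only
-- coefficients of degree at most `n`, which are already Catalan numbers.
catalan-equation : cS ≐ 𝟙 ⊕ (X ⊛ (cS ⊛ cS))
catalan-equation = coeffs λ n → begin
  cS n
    ≡⟨ H-catalan (suc n) n (ℕP.n≤1+n n) ⟨
  H (suc (suc n)) n
    ≡⟨ coeff (H-recurrence (suc n)) n ⟩
  𝟙 n + (X ⊛ (H (suc n) ⊛ H (suc (suc n)))) n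
    ≡⟨ cong (λ z → 𝟙 n + z) (⊛-cong-≤ {X} {X} n (λ _ _ → refl) λ k k≤n →
         ⊛-cong-≤ {H (suc n)} {cS} {H (suc (suc n))} {cS} k
           (λ j j≤k → H-catalan n j (ℕP.≤-trans j≤k k≤n))
           (λ j j≤k → H-catalan (suc n) j (ℕP.m≤n⇒m≤1+n (ℕP.≤-trans j≤k k≤n)))) ⟩
  𝟙 n + (X ⊛ (cS ⊛ cS)) n ∎
  where open ≡-Reasoning

cS≐1+C : cS ≐ 𝟙 ⊕ CS
cS≐1+C = coeffs λ n → trans (sym (cancel (oneS n) (cS n))) (cong (_+ CS n) (oneS≗const n))
  where
  cancel : ∀ a b → a + (b ℤ.- a) ≡ b
  cancel a b = trans (cong (λ z → a + z) (ℤP.+-comm b (- a)))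
    (trans (sym (ℤP.+-assoc a (- a) b)) (trans (cong (_+ b) (ℤP.+-inverseʳ a)) (ℤP.+-identityˡ b)))

X-in-terms-of-C : X ⊛ ((𝟙 ⊕ CS) ⊛ (𝟙 ⊕ CS)) ≐ CS
X-in-terms-of-C =
  eliminate (⊝ 𝟙) catalan-equation
    (eliminate (𝟙 ⊖ (X ⊛ (cS ⊕ (𝟙 ⊕ CS)))) cS≐1+C
      (solve 3 (λ x c d →
        let e = con 1ℤ :+ d
            m = con 1ℤ :- x :* (c :+ e)
        in (x :* (e :* e) :+ (:- con 1ℤ) :* (con 1ℤ :+ x :* (c :* c))) :+ m :* e
           := (d :+ (:- con 1ℤ) :* c) :+ m :* c)
        ≐-refl X cS CS))

-- G_a G_b is linear in G_a and G_b up to the factor x, with coefficients depending only on a − b.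
product-formula : ∀ e c → (𝟙 ⊖ H c) ⊕ (X ⊛ (H (suc e ℕ.+ c) ⊛ H c))
                        ≐ (𝟙 ⊖ (X ⊛ H e)) ⊛ (H (suc e ℕ.+ c) ⊖ H c)
-- Since `H 0` vanishes, this case reads 1 = (1 - x H_e) H_{e+1}, which is the recurrence.
product-formula e zero rewrite ℕP.+-identityʳ e =
  eliminate (⊝ 𝟙) (H-recurrence e)
    (eliminate (X ⊛ (H (suc e) ⊖ H e)) zeroS≐const
      (solve 4 (λ x z h h′ →
        let m = x :* (h′ :- h)
        in (((con 1ℤ :- z) :+ x :* (h′ :* z)) :+ (:- con 1ℤ) :* (con 1ℤ :+ x :* (h :* h′))) :+ m :* con 0ℤ
           := ((con 1ℤ :- x :* h) :* (h′ :- z) :+ (:- con 1ℤ) :* h′) :+ m :* z)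
        ≐-refl X zeroS (H e) (H (suc e))))
product-formula e (suc c) rewrite ℕP.+-suc e c =
  -- Multiply the formula for `c` by x A′ B′ and replace x A A′ by A′ - 1 and x B B′ by B′ - 1; the
  -- result is the formula for `suc c`.
  eliminate m₁ (product-formula e c)
    (eliminate m₂ (H-recurrence (suc e ℕ.+ c))
      (eliminate m₃ (H-recurrence c)
        (solve 6 (λ x h a a′ b b′ →
          let v  = con 1ℤ :- x :* h
              m₁ = x :* (a′ :* b′)
              m₂ = x :* (b :* b′) :- v :* b′
              m₃ = v :* a′ :- con 1ℤ
          in (((((con 1ℤ :- b′) :+ x :* (a′ :* b′))
               :+ m₁ :* (v :* (a :- b))) :+ m₂ :* (con 1ℤ :+ x :* (a :* a′))) :+ m₃ :* (con 1ℤ :+ x :* (b :* b′)))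
             := (((v :* (a′ :- b′) :+ m₁ :* ((con 1ℤ :- b) :+ x :* (a :* b))) :+ m₂ :* a′) :+ m₃ :* b′))
          ≐-refl X (H e) A A′ B B′)))
  where
  A  = H (suc e ℕ.+ c)
  A′ = H (suc (suc e ℕ.+ c))
  B  = H c
  B′ = H (suc c)
  m₁ = X ⊛ (A′ ⊛ B′)
  V  = 𝟙 ⊖ (X ⊛ H e)
  m₂ = (X ⊛ (B ⊛ B′)) ⊖ (V ⊛ B′)
  m₃ = (V ⊛ A′) ⊖ 𝟙

-- Rational functions of C

-- Horner's scheme as a predicate on series up to `≐`. Closure under the ring operations then needs
-- no separate arithmetic of coefficient lists.
data PolyInC : Series → Set where
  nil  : ∀ {a} → a ≐ constS 0ℤ → PolyInC a
  cons : ∀ k {a b} → PolyInC b → a ≐ constS k ⊕ (CS ⊛ b) → PolyInC a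

poly-resp : ∀ {a b} → a ≐ b → PolyInC b → PolyInC a
poly-resp a≐b (nil p)      = nil (≐-trans a≐b p)
poly-resp a≐b (cons k t p) = cons k t (≐-trans a≐b p)

poly-const : ∀ k → PolyInC (constS k)
poly-const k = cons k (nil ≐-refl)
  (solve 2 (λ k c → k := k :+ c :* con 0ℤ) ≐-refl (constS k) CS)

poly-C* : ∀ {a} → PolyInC a → PolyInC (CS ⊛ a)
poly-C* {a} t = cons 0ℤ t (solve 1 (λ a → a := con 0ℤ :+ a) ≐-refl (CS ⊛ a))

poly-⊕ : ∀ {a b} → PolyInC a → PolyInC b → PolyInC (a ⊕ b)
poly-⊕ {b = b} (nil p) t =
  poly-resp (≐-trans (⊕-cong p (≐-refl {b})) (solve 1 (λ b → con 0ℤ :+ b := b) ≐-refl b)) t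
poly-⊕ {a} t@(cons _ _ _) (nil q) =
  poly-resp (≐-trans (⊕-congˡ a q) (solve 1 (λ a → a :+ con 0ℤ := a) ≐-refl a)) t
poly-⊕ (cons j {b = a} s p) (cons k {b = b} t q) = cons (j + k) (poly-⊕ s t)
  (≐-trans (⊕-cong p q) (≐-trans
    (solve 5 (λ j k c a b → (j :+ c :* a) :+ (k :+ c :* b) := (j :+ k) :+ c :* (a :+ b))
      ≐-refl (constS j) (constS k) CS a b)
    (⊕-cong (≐-sym (+-homo j k)) (≐-refl {CS ⊛ (a ⊕ b)}))))
  where open _-Raw-AlmostCommutative⟶_ constHom

poly-const* : ∀ j {b} → PolyInC b → PolyInC (constS j ⊛ b)
poly-const* j (nil q) = nil (≐-trans (⊛-congˡ (constS j) q)
  (solve 1 (λ j → j :* con 0ℤ := con 0ℤ) ≐-refl (constS j)))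
poly-const* j (cons k {b = b} t q) = cons (j * k) (poly-const* j t)
  (≐-trans (⊛-congˡ (constS j) q) (≐-trans
    (solve 4 (λ j k c b → j :* (k :+ c :* b) := j :* k :+ c :* (j :* b)) ≐-refl (constS j) (constS k) CS b)
    (⊕-cong (≐-sym (*-homo j k)) (≐-refl {CS ⊛ (constS j ⊛ b)}))))
  where open _-Raw-AlmostCommutative⟶_ constHom

poly-⊛ : ∀ {a b} → PolyInC a → PolyInC b → PolyInC (a ⊛ b)
poly-⊛ {b = b} (nil p) t = nil (≐-trans (⊛-cong p (≐-refl {b}))
  (solve 1 (λ b → con 0ℤ :* b := con 0ℤ) ≐-refl b))
poly-⊛ {b = b} (cons j {b = a} s p) t =
  poly-resp (≐-trans (⊛-cong p (≐-refl {b}))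
    (solve 4 (λ j c a b → (j :+ c :* a) :* b := j :* b :+ c :* (a :* b)) ≐-refl (constS j) CS a b))
    (poly-⊕ (poly-const* j t) (poly-C* (poly-⊛ s t)))

-- Polynomials in C whose lowest nonzero coefficient is 1. The form C^j (1 + C b) is stable under
-- products and exhibits the nonzero coefficient that the final statement demands.
data Denominator : Series → Set where
  unit  : ∀ {a b} → PolyInC b → a ≐ 𝟙 ⊕ (CS ⊛ b) → Denominator a
  shift : ∀ {a b} → Denominator b → a ≐ CS ⊛ b → Denominator a

denominator⇒poly : ∀ {a} → Denominator a → PolyInC a
denominator⇒poly (unit t p)  = cons 1ℤ t p
denominator⇒poly (shift d p) = poly-resp p (poly-C* (denominator⇒poly d))

denominator-⊛ : ∀ {a b} → Denominator a → Denominator b → Denominator (a ⊛ b)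
denominator-⊛ {b = b} (shift {b = a} d p) e = shift (denominator-⊛ d e)
  (≐-trans (⊛-cong p (≐-refl {b})) (solve 3 (λ c a b → (c :* a) :* b := c :* (a :* b)) ≐-refl CS a b))
denominator-⊛ {a} d@(unit _ _) (shift {b = b} e q) = shift (denominator-⊛ d e)
  (≐-trans (⊛-congˡ a q) (solve 3 (λ c a b → a :* (c :* b) := c :* (a :* b)) ≐-refl CS a b))
denominator-⊛ (unit {b = a} s p) (unit {b = b} t q) =
  unit (poly-⊕ (poly-⊕ s t) (poly-C* (poly-⊛ s t)))
    (≐-trans (⊛-cong p q)
      (solve 3 (λ c a b → (con 1ℤ :+ c :* a) :* (con 1ℤ :+ c :* b)
        := con 1ℤ :+ c :* ((a :+ b) :+ c :* (a :* b))) ≐-refl CS a b))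

data Rational (a : Series) : Set where
  quotient : ∀ {d p} → Denominator d → PolyInC p → a ⊛ d ≐ p → Rational a

poly⇒rational : ∀ {a} → PolyInC a → Rational a
poly⇒rational {a} t = quotient
  (unit (nil ≐-refl) (solve 1 (λ c → con 1ℤ := con 1ℤ :+ c :* con 0ℤ) ≐-refl CS)) t
  (solve 1 (λ a → a :* con 1ℤ := a) ≐-refl a)

rational-resp : ∀ {a b} → a ≐ b → Rational b → Rational a
rational-resp a≐b (quotient {d} D P eq) = quotient D P (≐-trans (⊛-cong a≐b (≐-refl {d})) eq)

rational-/ : ∀ {a b d} → Denominator d → Rational b → a ⊛ d ≐ b → Rational a
rational-/ {a} {b} {d} D (quotient {e} E Q eq) ad≐b = quotient (denominator-⊛ D E) Q
  (≐-trans (solve 3 (λ a d e → a :* (d :* e) := (a :* d) :* e) ≐-refl a d e)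
    (≐-trans (⊛-cong ad≐b (≐-refl {e})) eq))

rational-⊛ : ∀ {a b} → Rational a → Rational b → Rational (a ⊛ b)
rational-⊛ {a} {b} (quotient {d} D P eq) (quotient {e} E Q eq′) =
  quotient (denominator-⊛ D E) (poly-⊛ P Q)
    (≐-trans (solve 4 (λ a b d e → (a :* b) :* (d :* e) := (a :* d) :* (b :* e)) ≐-refl a b d e)
      (⊛-cong eq eq′))

rational-⊕ : ∀ {a b} → Rational a → Rational b → Rational (a ⊕ b)
rational-⊕ {a} {b} (quotient {d} D P eq) (quotient {e} E Q eq′) =
  quotient (denominator-⊛ D E)
    (poly-⊕ (poly-⊛ P (denominator⇒poly E)) (poly-⊛ Q (denominator⇒poly D)))
    (≐-trans (solve 4 (λ a b d e → (a :+ b) :* (d :* e) := (a :* d) :* e :+ (b :* e) :* d) ≐-refl a b d e)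
      (⊕-cong (⊛-cong eq (≐-refl {e})) (⊛-cong eq′ (≐-refl {d}))))

rational-const : ∀ k → Rational (constS k)
rational-const k = poly⇒rational (poly-const k)

rational-⊝ : ∀ {a} → Rational a → Rational (⊝ a)
rational-⊝ {a} R = rational-resp (solve 1 (λ a → :- a := con (- 1ℤ) :* a) ≐-refl a)
  (rational-⊛ (rational-const (- 1ℤ)) R)

evalPoly-of : ∀ {a} → PolyInC a → Σ Poly λ P → a ≐ evalPoly P CS
evalPoly-of (nil p) = [] , ≐-trans p (≐-sym zeroS≐const)
evalPoly-of (cons k t p) with evalPoly-of t
... | P , eq = k ∷ P , ≐-trans p (⊕-congˡ (constS k) (⊛-congˡ CS eq))

evalPoly-of-denominator : ∀ {a} → Denominator a →
  Σ Poly λ R → Any (λ k → ¬ (k ≡ 0ℤ)) R × a ≐ evalPoly R CS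
evalPoly-of-denominator (unit t p) with evalPoly-of t
... | P , eq = 1ℤ ∷ P , here (λ ()) , ≐-trans p (⊕-congˡ 𝟙 (⊛-congˡ CS eq))
evalPoly-of-denominator (shift {b = b} d p) with evalPoly-of-denominator d
... | R , nonzero , eq = 0ℤ ∷ R , there nonzero ,
  ≐-trans p (≐-trans (⊛-congˡ CS eq)
    (solve 1 (λ s → s := con 0ℤ :+ s) ≐-refl (CS ⊛ evalPoly R CS)))

rational⇒isRationalFunctionOfC : ∀ {a} → Rational a → IsRationalFunctionOfC a
rational⇒isRationalFunctionOfC {a} (quotient D P eq)
  with evalPoly-of P | evalPoly-of-denominator D
... | P′ , p≐ | R , nonzero , d≐ =
  P′ , R , nonzero , coeff (≐-trans (⊛-congˡ a (≐-sym d≐)) (≐-trans eq p≐))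

poly-C : PolyInC CS
poly-C = poly-resp (solve 1 (λ c → c := c :* con 1ℤ) ≐-refl CS) (poly-C* (poly-const 1ℤ))

poly-1+C : PolyInC (𝟙 ⊕ CS)
poly-1+C = poly-⊕ (poly-const 1ℤ) poly-C

denominator-1+C : Denominator (𝟙 ⊕ CS)
denominator-1+C = unit (poly-const 1ℤ)
  (solve 1 (λ c → con 1ℤ :+ c := con 1ℤ :+ c :* con 1ℤ) ≐-refl CS)

denominator-C : Denominator CS
denominator-C = shift (unit (nil ≐-refl) ≐-refl)
  (solve 1 (λ c → c := c :* (con 1ℤ :+ c :* con 0ℤ)) ≐-refl CS)

rational-X : Rational X
rational-X = rational-/ (denominator-⊛ denominator-1+C denominator-1+C) (poly⇒rational poly-C)
  X-in-terms-of-C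

rational-cS : Rational cS
rational-cS = rational-resp cS≐1+C (poly⇒rational poly-1+C)

-- This is (1 - C^k)/(1 - C). With the factor 1 - C cancelled from the closed form, the denominator
-- `geometric (suc k)` is a `unit` by definition.
geometric : ℕ → Series
geometric zero    = constS 0ℤ
geometric (suc k) = 𝟙 ⊕ (CS ⊛ geometric k)

poly-geometric : ∀ k → PolyInC (geometric k)
poly-geometric zero    = nil ≐-refl
poly-geometric (suc k) = cons 1ℤ (poly-geometric k) ≐-refl

H-closed-form : ∀ k → H k ⊛ geometric (suc k) ≐ (𝟙 ⊕ CS) ⊛ geometric k
H-closed-form zero = eliminate (geometric 1) zeroS≐const
  (solve 3 (λ c z g → z :* g :+ g :* con 0ℤ := (con 1ℤ :+ c) :* con 0ℤ :+ g :* z)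
    ≐-refl CS zeroS (geometric 1))
H-closed-form (suc k) =
  -- Times (1+C)β, the recurrence has last term x (1+C) H_{k+1} (H_k β). By induction and x (1+C)² =
  -- C this is C g H_{k+1}, where g = `geometric k`; finally (1+C)β - C g = 1 + Cβ.
  eliminate (C₁ ⊛ β) (H-recurrence k)
    (eliminate (C₁ ⊛ (X ⊛ H (suc k))) (H-closed-form k)
      (eliminate (H (suc k) ⊛ geometric k) X-in-terms-of-C
        (solve 5 (λ x c h h′ g →
          let c₁ = con 1ℤ :+ c
              b  = con 1ℤ :+ c :* g
              m₁ = c₁ :* b
              m₂ = c₁ :* (x :* h′)
              m₃ = h′ :* g
          in ((h′ :* (con 1ℤ :+ c :* b) :+ m₁ :* (con 1ℤ :+ x :* (h :* h′))) :+ m₂ :* (c₁ :* g)) :+ m₃ :* c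
             := ((c₁ :* b :+ m₁ :* h′) :+ m₂ :* (h :* b)) :+ m₃ :* (x :* (c₁ :* c₁)))
          ≐-refl X CS (H k) (H (suc k)) (geometric k))))
  where
  C₁ = 𝟙 ⊕ CS
  β = geometric (suc k)

rational-H : ∀ k → Rational (H k)
rational-H k = rational-/ (unit (poly-geometric k) ≐-refl)
  (poly⇒rational (poly-⊛ poly-1+C (poly-geometric k))) (H-closed-form k)

-- Sums of series with rational value

-- Asks for all coefficients up to `N` at once, where `IsXAdicSum` asks for one: a coefficient of
-- `u ⊛ A M` depends on all the lower ones of `A M`.
Limit : (ℕ → Series) → Series → Set
Limit A S = ∀ N → Σ ℕ λ M → ∀ M′ → M ℕ.≤ M′ → ∀ k → k ℕ.≤ N → A M′ k ≡ S k

limit-resp : ∀ {A B S} → (∀ M → A M ≐ B M) → Limit B S → Limit A S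
limit-resp A≐B lim N with lim N
... | M , stable = M , λ M′ M≤M′ k k≤N → trans (coeff (A≐B M′) k) (stable M′ M≤M′ k k≤N)

limit-⊕ : ∀ {A B S T} → Limit A S → Limit B T → Limit (λ M → A M ⊕ B M) (S ⊕ T)
limit-⊕ lim lim′ N with lim N | lim′ N
... | M₁ , stable₁ | M₂ , stable₂ = M₁ ℕ.⊔ M₂ , λ M′ M≤M′ k k≤N → cong₂ _+_
  (stable₁ M′ (ℕP.≤-trans (ℕP.m≤m⊔n M₁ M₂) M≤M′) k k≤N)
  (stable₂ M′ (ℕP.≤-trans (ℕP.m≤n⊔m M₁ M₂) M≤M′) k k≤N)

limit-⊛ : ∀ u {A S} → Limit A S → Limit (λ M → u ⊛ A M) (u ⊛ S)
limit-⊛ u {A} {S} lim N with lim N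
... | M , stable = M , λ M′ M≤M′ k k≤N → ⊛-cong-≤ {u} {u} {A M′} {S} k (λ _ _ → refl)
  (λ j j≤k → stable M′ M≤M′ j (ℕP.≤-trans j≤k k≤N))

limit-const : ∀ S → Limit (λ _ → S) S
limit-const S N = 0 , λ _ _ _ _ → refl

limit-H : ∀ m → Limit (λ M → H (suc (M ℕ.+ m))) cS
limit-H m N = N , λ M′ N≤M′ k k≤N →
  H-catalan (M′ ℕ.+ m) k (ℕP.≤-trans k≤N (ℕP.≤-trans N≤M′ (ℕP.m≤m+n M′ m)))

sumS-resp : ∀ {T U} → (∀ n → T n ≐ U n) → ∀ M → sumS T M ≐ sumS U M
sumS-resp T≐U zero    = ≐-refl
sumS-resp T≐U (suc M) = ⊕-cong (sumS-resp T≐U M) (T≐U M)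

sumS-⊕ : ∀ T U M → sumS (λ n → T n ⊕ U n) M ≐ sumS T M ⊕ sumS U M
sumS-⊕ T U zero    = coeffs λ _ → refl
sumS-⊕ T U (suc M) = ≐-trans (⊕-cong (sumS-⊕ T U M) (≐-refl {T M ⊕ U M}))
  (solve 4 (λ a b c d → (a :+ b) :+ (c :+ d) := (a :+ c) :+ (b :+ d)) ≐-refl
    (sumS T M) (sumS U M) (T M) (U M))

sumS-⊛ : ∀ u T M → sumS (λ n → u ⊛ T n) M ≐ u ⊛ sumS T M
sumS-⊛ u T zero    = ≐-trans zeroS≐const (≐-trans
  (solve 1 (λ u → con 0ℤ := u :* con 0ℤ) ≐-refl u) (⊛-congˡ u (≐-sym zeroS≐const)))
sumS-⊛ u T (suc M) = ≐-trans (⊕-cong (sumS-⊛ u T M) (≐-refl {u ⊛ T M}))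
  (solve 3 (λ u a b → u :* a :+ u :* b := u :* (a :+ b)) ≐-refl u (sumS T M) (T M))

sumS-front : ∀ T M → sumS T (suc M) ≐ T 0 ⊕ sumS (λ n → T (suc n)) M
sumS-front T zero    = coeffs λ n → ℤP.+-comm 0ℤ (T 0 n)
sumS-front T (suc M) = ≐-trans (⊕-cong (sumS-front T M) (≐-refl {T (suc M)}))
  (coeffs λ n → ℤP.+-assoc (T 0 n) _ _)

data Summable (T : ℕ → Series) : Set where
  sums-to : ∀ {S} → Limit (sumS T) S → Rational S → Summable T

summable-resp : ∀ {T U} → (∀ n → T n ≐ U n) → Summable U → Summable T
summable-resp T≐U (sums-to lim R) = sums-to (limit-resp (sumS-resp T≐U) lim) R

summable-⊕ : ∀ {T U} → Summable T → Summable U → Summable (λ n → T n ⊕ U n)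
summable-⊕ {T} {U} (sums-to lim R) (sums-to lim′ R′) =
  sums-to (limit-resp (sumS-⊕ T U) (limit-⊕ lim lim′)) (rational-⊕ R R′)

summable-⊛ : ∀ {u T} → Rational u → Summable T → Summable (λ n → u ⊛ T n)
summable-⊛ {u} {T} Q (sums-to lim R) =
  sums-to (limit-resp (sumS-⊛ u T) (limit-⊛ u lim)) (rational-⊛ Q R)

summable-prefix : ∀ {T} → Rational (T 0) → Summable (λ n → T (suc n)) → Summable T
summable-prefix {T} Q (sums-to {S} lim R) = sums-to lim′ (rational-⊕ Q R)
  where
  lim′ : Limit (sumS T) (T 0 ⊕ S)
  lim′ N with lim N
  ... | M , stable = suc M , λ
    { (suc M′) (s≤s M≤M′) k k≤N → trans (coeff (sumS-front T M′) k)
        (cong (λ z → T 0 k + z) (stable M′ M≤M′ k k≤N)) }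

-- Dividing by x amounts to multiplying by (1+C)²/C.
summable-X⁻¹ : ∀ {T} → Summable (λ n → X ⊛ T n) → Summable T
summable-X⁻¹ {T} (sums-to {S} lim R) = sums-to lim′ rational
  where
  lim′ : Limit (sumS T) (tail S)
  lim′ N with lim (suc N)
  ... | M , stable = M , λ M′ M≤M′ k k≤N →
    trans (sym (trans (coeff (sumS-⊛ X T M′) (suc k)) (X-⊛-suc (sumS T M′) k)))
      (stable M′ M≤M′ (suc k) (s≤s k≤N))
  -- Every partial sum is a multiple of x, hence so is the limit, and x can be divided out by
  -- shifting.
  S₀ : S 0 ≡ 0ℤ
  S₀ with lim 0
  ... | M , stable = trans (sym (stable M ℕP.≤-refl 0 z≤n))
    (trans (coeff (sumS-⊛ X T M) 0) (X-⊛-zero (sumS T M)))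
  X-tail : X ⊛ tail S ≐ S
  X-tail = coeffs λ { zero → trans (X-⊛-zero (tail S)) (sym S₀) ; (suc n) → X-⊛-suc (tail S) n }
  C₁ = 𝟙 ⊕ CS
  rational : Rational (tail S)
  rational = rational-/ denominator-C (rational-⊛ R (poly⇒rational (poly-⊛ poly-1+C poly-1+C)))
    (≐-trans (⊛-congˡ (tail S) (≐-sym X-in-terms-of-C))
      (≐-trans (solve 3 (λ s x c → s :* (x :* c) := (x :* s) :* c) ≐-refl (tail S) X (C₁ ⊛ C₁))
        (⊛-cong X-tail (≐-refl {C₁ ⊛ C₁}))))

summable⇒sum : ∀ {T} → Summable T → Σ Series λ S → IsXAdicSum T S × IsRationalFunctionOfC S
summable⇒sum (sums-to {S} lim R) = S , xadic , rational⇒isRationalFunctionOfC R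
  where
  xadic : IsXAdicSum _ S
  xadic N with lim N
  ... | M , stable = M , λ M′ M≤M′ → stable M′ M≤M′ N ℕP.≤-refl

-- The summation

ΔH : ℕ → ℕ → ℕ → Series
ΔH m k n = H (suc (n ℕ.+ m)) ⊖ H (suc (n ℕ.+ k))

summable-ΔH-step : ∀ m → Summable (ΔH (suc m) m)
summable-ΔH-step m = sums-to (limit-resp telescope (limit-⊕ (limit-H m) (limit-const (⊝ H (suc m)))))
  (rational-⊕ rational-cS (rational-⊝ (rational-H (suc m))))
  where
  telescope : ∀ M → sumS (ΔH (suc m) m) M ≐ H (suc (M ℕ.+ m)) ⊕ (⊝ H (suc m))
  telescope zero = ≐-trans zeroS≐const
    (solve 1 (λ h → con 0ℤ := h :- h) ≐-refl (H (suc m)))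
  telescope (suc M) rewrite ℕP.+-suc M m =
    ≐-trans (⊕-cong (telescope M) (≐-refl {H (suc (suc (M ℕ.+ m))) ⊖ H (suc (M ℕ.+ m))}))
      (solve 3 (λ a b c → (a :- b) :+ (c :- a) := c :- b) ≐-refl
        (H (suc (M ℕ.+ m))) (H (suc m)) (H (suc (suc (M ℕ.+ m)))))

summable-ΔH-0 : ∀ m → Summable (ΔH m 0)
-- The zero sequence is written as 0 times a sequence known to be summable.
summable-ΔH-0 zero = summable-resp
  (λ n → solve 2 (λ a b → a :- a := con 0ℤ :* b) ≐-refl (H (suc (n ℕ.+ 0))) (ΔH 1 0 n))
  (summable-⊛ (rational-const 0ℤ) (summable-ΔH-step 0))
summable-ΔH-0 (suc m) = summable-resp
  (λ n → solve 3 (λ a b c → a :- c := (a :- b) :+ (b :- c)) ≐-refl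
    (H (suc (n ℕ.+ suc m))) (H (suc (n ℕ.+ m))) (H (suc (n ℕ.+ 0))))
  (summable-⊕ (summable-ΔH-step m) (summable-ΔH-0 m))

summable-ΔH : ∀ m k → Summable (ΔH m k)
summable-ΔH m k = summable-resp
  (λ n → solve 3 (λ a b c → a :- b := (a :- c) :+ con (- 1ℤ) :* (b :- c)) ≐-refl
    (H (suc (n ℕ.+ m))) (H (suc (n ℕ.+ k))) (H (suc (n ℕ.+ 0))))
  (summable-⊕ (summable-ΔH-0 m) (summable-⊛ (rational-const (- 1ℤ)) (summable-ΔH-0 k)))

ℕ+-exchange : ∀ n e k → n ℕ.+ (e ℕ.+ suc k) ≡ e ℕ.+ suc (n ℕ.+ k)
ℕ+-exchange = ℕR.solve-∀

product-above : ∀ e k n → let m = e ℕ.+ suc k in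
  X ⊛ (H (suc (n ℕ.+ m)) ⊛ H (suc (n ℕ.+ k)))
    ≐ ((𝟙 ⊖ (X ⊛ H e)) ⊛ ΔH m k n) ⊕ (H (suc (n ℕ.+ k)) ⊖ 𝟙)
product-above e k n rewrite ℕ+-exchange n e k =
  eliminate 𝟙 (product-formula e (suc (n ℕ.+ k)))
    (solve 4 (λ x h a b → let v = con 1ℤ :- x :* h in
      x :* (a :* b) :+ con 1ℤ :* (v :* (a :- b))
      := (v :* (a :- b) :+ (b :- con 1ℤ)) :+ con 1ℤ :* ((con 1ℤ :- b) :+ x :* (a :* b)))
      ≐-refl X (H e) (H (suc e ℕ.+ suc (n ℕ.+ k))) (H (suc (n ℕ.+ k))))

-- `u` is chosen before `n`, since the product formula's coefficient sees only the difference of the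
-- indices. In both orders of `m` and `k` the remainder is made to involve `k` alone, so that it
-- cancels between two products sharing the factor with index `k`.
product-linear : ∀ m k → m ≢ k → Σ Series λ u → Rational u × (∀ n →
  X ⊛ (H (suc (n ℕ.+ m)) ⊛ H (suc (n ℕ.+ k))) ≐ (u ⊛ ΔH m k n) ⊕ (H (suc (n ℕ.+ k)) ⊖ 𝟙))
product-linear m k m≢k with ℕP.<-cmp m k
... | tri≈ _ m≡k _ = ⊥-elim (m≢k m≡k)
... | tri> _ _ k<m = 𝟙 ⊖ (X ⊛ H e) ,
  rational-⊕ (rational-const 1ℤ) (rational-⊝ (rational-⊛ rational-X (rational-H e))) ,
  λ n → subst (λ m → X ⊛ (H (suc (n ℕ.+ m)) ⊛ H (suc (n ℕ.+ k)))
      ≐ ((𝟙 ⊖ (X ⊛ H e)) ⊛ ΔH m k n) ⊕ (H (suc (n ℕ.+ k)) ⊖ 𝟙))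
    (ℕP.m∸n+n≡m k<m) (product-above e k n)
  where e = m ℕ.∸ suc k
... | tri< m<k _ _ = X ⊛ H e , rational-⊛ rational-X (rational-H e) ,
  λ n → subst (λ k → X ⊛ (H (suc (n ℕ.+ m)) ⊛ H (suc (n ℕ.+ k)))
      ≐ ((X ⊛ H e) ⊛ ΔH m k n) ⊕ (H (suc (n ℕ.+ k)) ⊖ 𝟙))
    (ℕP.m∸n+n≡m m<k) (swapped n)
  where
  e = k ℕ.∸ suc m
  k′ = e ℕ.+ suc m
  swapped : ∀ n → X ⊛ (H (suc (n ℕ.+ m)) ⊛ H (suc (n ℕ.+ k′)))
                ≐ ((X ⊛ H e) ⊛ ΔH m k′ n) ⊕ (H (suc (n ℕ.+ k′)) ⊖ 𝟙)
  -- Here `product-above` leaves a remainder in `m`. Rewriting it in terms of the other index turns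
  -- the coefficient v = 1 - x H_e into 1 - v = x H_e.
  swapped n = eliminate 𝟙 (product-above e m n)
    (solve 4 (λ x h a b → let v = con 1ℤ :- x :* h in
      x :* (a :* b) :+ con 1ℤ :* (v :* (b :- a) :+ (a :- con 1ℤ))
      := (x :* h :* (a :- b) :+ (b :- con 1ℤ)) :+ con 1ℤ :* (x :* (b :* a)))
      ≐-refl X (H e) (H (suc (n ℕ.+ m))) (H (suc (n ℕ.+ k′))))

-- Induction on the remaining factors. The first of them, with index `k`, is absorbed and becomes
-- the partner of `m` in one recursive sum and of `m′` in the other, which is why uniqueness is
-- stated for each of the two separately. Each round costs a factor x, removed by `summable-X⁻¹`.
summable-product : ∀ ks m m′ → Unique (m ∷ ks) → Unique (m′ ∷ ks) →
                   Summable (summand (+ m) (+ m′) (map +_ ks))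
summable-product [] m m′ _ _ = summable-resp
  (λ n → ≐-trans (⊛-congˡ (ΔH m m′ n) (coeffs oneS≗const))
    (solve 1 (λ d → d :* con 1ℤ := d) ≐-refl (ΔH m m′ n)))
  (summable-ΔH m m′)
summable-product (k ∷ ks) m m′ ((m≢k ∷ m∉ks) ∷ uks@(_ ∷ u)) ((m′≢k ∷ m′∉ks) ∷ _)
  with product-linear m k m≢k | product-linear m′ k m′≢k
... | v , rv , linear | v′ , rv′ , linear′ = summable-X⁻¹ (summable-resp reduce
  (summable-⊕ (summable-⊛ rv (summable-product ks m k (m∉ks ∷ u) uks))
    (summable-⊛ (rational-⊝ rv′) (summable-product ks m′ k (m′∉ks ∷ u) uks))))
  where
  reduce : ∀ n → X ⊛ summand (+ m) (+ m′) (+ k ∷ map +_ ks) n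
    ≐ (v ⊛ summand (+ m) (+ k) (map +_ ks) n) ⊕ ((⊝ v′) ⊛ summand (+ m′) (+ k) (map +_ ks) n)
  reduce n = eliminate P (linear n) (eliminate (⊝ P) (linear′ n)
    (solve 7 (λ x a b c v v′ p →
      let u = p :* (v :* (a :- c) :+ (c :- con 1ℤ))
          u′ = (:- p) :* (v′ :* (b :- c) :+ (c :- con 1ℤ))
      in (x :* ((a :- b) :* (c :* p)) :+ u) :+ u′
         := ((v :* ((a :- c) :* p) :+ (:- v′) :* ((b :- c) :* p)) :+ p :* (x :* (a :* c)))
            :+ (:- p) :* (x :* (b :* c)))
      ≐-refl X (H (suc (n ℕ.+ m))) (H (suc (n ℕ.+ m′))) (H (suc (n ℕ.+ k))) v v′ P))
    where P = prodS (map (λ i → G (+ n + i)) (map +_ ks))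

-- Passage from natural to integer indices

G-negative : ∀ m → G -[1+ m ] ≐ constS 0ℤ
G-negative m = coeffs λ n → trans (cong +_
  (trans (count-filters (λ p → height p ℤP.≤? -[1+ m ]) isDyck (allPaths (2 ℕ.* n)))
    (trans (count-cong too-high (allPaths (2 ℕ.* n))) (count-false (allPaths (2 ℕ.* n)))))) (zeros n)
  where
  absurd : ¬ 0ℤ ℤ.≤ -[1+ m ]
  absurd ()
  too-high : ∀ p → ⌊ height p ℤP.≤? -[1+ m ] ⌋ ∧ isDyck p ≡ Bool.false
  too-high p rewrite ⌊⌋-false (height p ℤP.≤? -[1+ m ])
    (λ h≤ → absurd (ℤP.≤-trans (ℤP.i≤i⊔j 0ℤ (maxList (levelsFrom 0ℤ p))) h≤)) = refl
  zeros : ∀ n → 0ℤ ≡ constS 0ℤ n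
  zeros zero    = refl
  zeros (suc n) = refl

rational-G : ∀ z → Rational (G z)
rational-G (+ k)    = rational-H (suc k)
rational-G -[1+ m ] = rational-resp (G-negative m) (rational-const 0ℤ)

rational-summand : ∀ i i′ is n → Rational (summand i i′ is n)
rational-summand i i′ is n =
  rational-⊛ (rational-⊕ (rational-G (+ n + i)) (rational-⊝ (rational-G (+ n + i′)))) (rational-prod is)
  where
  rational-prod : ∀ js → Rational (prodS (map (λ j → G (+ n + j)) js))
  rational-prod []       = rational-resp (coeffs oneS≗const) (rational-const 1ℤ)
  rational-prod (j ∷ js) = rational-⊛ (rational-G (+ n + j)) (rational-prod js)

sucs : List ℤ → List ℤ
sucs = map (λ i → 1ℤ + i)

suc-index : ∀ n j → + suc n + j ≡ + n + (1ℤ + j)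
suc-index n j = trans (cong (λ k → + k + j) (ℕP.+-comm 1 n)) (ℤP.+-assoc (+ n) 1ℤ j)

summand-suc : ∀ i i′ is n → summand i i′ is (suc n) ≡ summand (1ℤ + i) (1ℤ + i′) (sucs is) n
summand-suc i i′ is n rewrite suc-index n i | suc-index n i′
  | sym (map-∘ {g = λ j → G (+ n + j)} {f = λ j → 1ℤ + j} is)
  | map-cong {f = λ j → G (+ suc n + j)} {g = λ j → G (+ n + (1ℤ + j))}
      (λ j → cong G (suc-index n j)) is = refl

Natural : ℕ → ℤ → Set
Natural K z = Σ ℕ λ m → + K + z ≡ + m

natural-abs : ∀ z → Natural ℤ.∣ z ∣ z
natural-abs (+ n)    = n ℕ.+ n , refl
natural-abs -[1+ n ] = 0 , ℤP.n⊖n≡0 (suc n)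

natural-+ : ∀ j K z → Natural K z → Natural (j ℕ.+ K) z
natural-+ j K z (m , eq) = j ℕ.+ m ,
  trans (ℤP.+-assoc (+ j) (+ K) z) (cong (λ y → + j + y) eq)

-- A shift by the absolute value makes an index natural and larger shifts keep it so; the sum of all
-- absolute values therefore serves every index.
all-natural : ∀ zs → Σ ℕ λ K → All (Natural K) zs
all-natural []       = 0 , []
all-natural (z ∷ zs) with all-natural zs
... | K , nat = K ℕ.+ ℤ.∣ z ∣ , natural-+ K ℤ.∣ z ∣ z (natural-abs z) ∷
  All.map (λ {y} p → subst (λ L → Natural L y) (ℕP.+-comm ℤ.∣ z ∣ K) (natural-+ ℤ.∣ z ∣ K y p)) nat

natural-suc : ∀ K z → Natural (suc K) z → Natural K (1ℤ + z)
natural-suc K z (m , eq) = m , trans (sym (suc-index K z)) eq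

naturals : ∀ {zs} → All (Natural 0) zs → Σ (List ℕ) λ ms → zs ≡ map +_ ms
naturals [] = [] , refl
naturals {z ∷ zs} ((m , eq) ∷ nat) with naturals nat
... | ms , eq′ = m ∷ ms , cong₂ _∷_ (trans (sym (ℤP.+-identityˡ z)) eq) eq′

unique-+⁻ : ∀ {ms} → Unique (map +_ ms) → Unique ms
unique-+⁻ {ms} u = AllPairs.map (λ ≢ eq → ≢ (cong +_ eq)) (AllPairsP.map⁻ u)

unique-sucs : ∀ {zs} → Unique zs → Unique (sucs zs)
unique-sucs = UniqueP.map⁺ λ {x} {y} eq → 
  trans (sym (ℤP.pred-suc x)) (trans (cong ℤ.pred eq) (ℤP.pred-suc y))

-- Dropping the first K terms shifts all the indices by K.
summable-shift : ∀ K i i′ is → All (Natural K) (i ∷ i′ ∷ is) →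
                 Unique (i ∷ is) → Unique (i′ ∷ is) → Summable (summand i i′ is)
summable-shift zero i i′ is nat u u′ with naturals nat
... | m ∷ m′ ∷ ks , refl = summable-product ks m m′ (unique-+⁻ u) (unique-+⁻ u′)
summable-shift (suc K) i i′ is nat u u′ = summable-prefix (rational-summand i i′ is 0)
  (summable-resp (λ n → coeffs λ k → cong (λ s → s k) (summand-suc i i′ is n))
    (summable-shift K (1ℤ + i) (1ℤ + i′) (sucs is)
      (AllP.map⁺ (All.map (λ {z} → natural-suc K z) nat)) (unique-sucs u) (unique-sucs u′)))

theorem3p4 : (i1 i1' : ℤ) (is : List ℤ) → Unique (i1 ∷ i1' ∷ is) →
    Σ Series λ S → IsXAdicSum (summand i1 i1' is) S × IsRationalFunctionOfC S
theorem3p4 i1 i1' is ((_ ∷ i1∉is) ∷ u′@(_ ∷ u)) with all-natural (i1 ∷ i1' ∷ is)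
... | K , nat = summable⇒sum (summable-shift K i1 i1' is nat (i1∉is ∷ u) u′)
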